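{- Work in $\mathsf{ZF}$. $\mathsf{EDM}$ implies $\mathsf{RT}$.
   Context: A set $X$ is countable if there is an injection $X\to\omega$, and uncountable otherwise. "Countably infinite" means in bijection with $\omega$. $[V]^2$ is the set of 2-element subsets of $V$; for $f:[V]^2\to k$, $S\subseteq V$ is monochromatic in color $i$ if $f(\{x,y\})=i$ for all distinct $x,y\in S$. $\mathsf{EDM}$: If $G=(V_G,E_G)$ is a graph with $V_G$ uncountable, then for every $f:[V_G]^2\to\{0,1\}$ either there is an uncountable set monochromatic in color $0$ or a countably infinite set monochromatic in color $1$. $\mathsf{RT}$ (Ramsey's Theorem): For every infinite set $A$ and every partition of $[A]^2$ into two sets $X$ and $Y$, there is an infinite $B\subseteq A$ with $[B]^2\subseteq X$ or $[B]^2\subseteq Y$. -}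

module Defs where

open import Level using (Level) renaming (suc to lsuc)
open import Data.Nat using (ℕ; suc)
open import Data.Fin using (Fin)
open import Data.Vec using (Vec; _∷_; lookup)
open import Data.Product using (∃; _×_)
open import Data.Sum using (_⊎_)
open import Relation.Nullary using (¬_)
open import Relation.Binary.PropositionalEquality using (_≡_; _≢_)

-- "In ZF, A implies B" is rendered as: every model of ZF satisfying A
-- satisfies B.  Models are ∈-structures with equality interpreted as identity;
-- no choice principle or excluded middle is assumed of the metatheory.

record Structure (ℓ : Level) : Set (lsuc ℓ) where
  infix 4 _∈_
  field
    Carrier : Set ℓ
    _∈_     : Carrier → Carrier → Set ℓ

-- Formulas of the language {∈, =} with free (de Bruijn) variables in Fin n.
data Formula (n : ℕ) : Set where
  _∈′_ _≡′_           : Fin n → Fin n → Formula n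
  ¬′_                 : Formula n → Formula n
  _∧′_ _∨′_ _⇒′_      : Formula n → Formula n → Formula n
  ∀′_ ∃′_             : Formula (suc n) → Formula n

module _ {ℓ : Level} (𝓜 : Structure ℓ) where
  open Structure 𝓜

  Sat : ∀ {n} → Formula n → Vec Carrier n → Set ℓ
  Sat (i ∈′ j) ρ = lookup ρ i ∈ lookup ρ j
  Sat (i ≡′ j) ρ = lookup ρ i ≡ lookup ρ j
  Sat (¬′ φ)   ρ = ¬ Sat φ ρ
  Sat (φ ∧′ ψ) ρ = Sat φ ρ × Sat ψ ρ
  Sat (φ ∨′ ψ) ρ = Sat φ ρ ⊎ Sat ψ ρ
  Sat (φ ⇒′ ψ) ρ = Sat φ ρ → Sat ψ ρ
  Sat (∀′ φ)   ρ = ∀ x → Sat φ (x ∷ ρ)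
  Sat (∃′ φ)   ρ = ∃ λ x → Sat φ (x ∷ ρ)

  -- ZF is a theory in classical logic, whereas Sat is read in Agda's
  -- intuitionistic logic; this says that 𝓜 validates every instance of φ ∨ ¬φ.
  Classical : Set ℓ
  Classical = ∀ {n} (φ : Formula n) (ρ : Vec Carrier n) → Sat (φ ∨′ (¬′ φ)) ρ

module SetTheory {ℓ : Level} (𝓜 : Structure ℓ) where
  open Structure 𝓜

  -- Everything in this module is built from ∈ and ≡ by connectives and
  -- quantifiers over Carrier, so each notion is literally (the value under Sat
  -- of) a first-order formula.  For that reason the biconditional is a pair of
  -- implications instead of the library's record _⇔_, and sets such as {x , y},
  -- ⟨x , y⟩ and ω are described by predicates instead of terms.

  infix 2 _⟷_
  _⟷_ : Set ℓ → Set ℓ → Set ℓ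
  P ⟷ Q = (P → Q) × (Q → P)

  infix 4 _⊆_
  _⊆_ : Carrier → Carrier → Set ℓ
  x ⊆ y = ∀ z → z ∈ x → z ∈ y

  IsEmpty : Carrier → Set ℓ
  IsEmpty x = ∀ z → ¬ (z ∈ x)

  -- u = {x , y}
  IsPair : Carrier → Carrier → Carrier → Set ℓ
  IsPair u x y = ∀ z → z ∈ u ⟷ (z ≡ x ⊎ z ≡ y)

  -- s = x ∪ {x}
  IsSuc : Carrier → Carrier → Set ℓ
  IsSuc s x = ∀ z → z ∈ s ⟷ (z ∈ x ⊎ z ≡ x)

  Inductive : Carrier → Set ℓ
  Inductive w =
    (∃ λ e → IsEmpty e × e ∈ w) ×
    (∀ x → x ∈ w → ∃ λ s → IsSuc s x × s ∈ w)

  -- w = ω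
  IsOmega : Carrier → Set ℓ
  IsOmega w = Inductive w × (∀ v → Inductive v → w ⊆ v)

  -- p = ⟨x , y⟩ = {{x} , {x , y}}
  IsOrderedPair : Carrier → Carrier → Carrier → Set ℓ
  IsOrderedPair p x y =
    ∃ λ s → ∃ λ t → IsPair s x x × IsPair t x y × IsPair p s t

  infix 4 ⟨_,_⟩∈_
  ⟨_,_⟩∈_ : Carrier → Carrier → Carrier → Set ℓ
  ⟨ x , y ⟩∈ f = ∃ λ p → IsOrderedPair p x y × p ∈ f

  -- f : X → Y
  IsFunction : Carrier → Carrier → Carrier → Set ℓ
  IsFunction f X Y =
    (∀ p → p ∈ f → ∃ λ x → ∃ λ y → x ∈ X × y ∈ Y × IsOrderedPair p x y) ×
    (∀ x → x ∈ X → ∃ λ y → ⟨ x , y ⟩∈ f) ×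
    (∀ x y y′ → ⟨ x , y ⟩∈ f → ⟨ x , y′ ⟩∈ f → y ≡ y′)

  IsInjection : Carrier → Carrier → Carrier → Set ℓ
  IsInjection f X Y =
    IsFunction f X Y ×
    (∀ x x′ y → ⟨ x , y ⟩∈ f → ⟨ x′ , y ⟩∈ f → x ≡ x′)

  IsBijection : Carrier → Carrier → Carrier → Set ℓ
  IsBijection f X Y =
    IsInjection f X Y × (∀ y → y ∈ Y → ∃ λ x → ⟨ x , y ⟩∈ f)

  Finite : Carrier → Set ℓ
  Finite X =
    ∃ λ w → IsOmega w × ∃ λ n → n ∈ w × ∃ λ f → IsBijection f X n

  Infinite : Carrier → Set ℓ
  Infinite X = ¬ Finite X

  Countable : Carrier → Set ℓ
  Countable X = ∃ λ w → IsOmega w × ∃ λ f → IsInjection f X w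

  Uncountable : Carrier → Set ℓ
  Uncountable X = ¬ Countable X

  CountablyInfinite : Carrier → Set ℓ
  CountablyInfinite X = ∃ λ w → IsOmega w × ∃ λ f → IsBijection f X w

  infix 4 _∈[_]²
  _∈[_]² : Carrier → Carrier → Set ℓ
  s ∈[ V ]² = ∃ λ x → ∃ λ y → x ∈ V × y ∈ V × x ≢ y × IsPair s x y

  -- P = [V]²
  IsPairSet : Carrier → Carrier → Set ℓ
  IsPairSet P V = ∀ s → s ∈ P ⟷ s ∈[ V ]²

  -- f({x , y}) = i for all distinct x, y ∈ S
  Monochromatic : Carrier → Carrier → Carrier → Set ℓ
  Monochromatic f i S =
    ∀ x y → x ∈ S → y ∈ S → x ≢ y → ∀ s → IsPair s x y → ⟨ s , i ⟩∈ f

  IsGraph : Carrier → Carrier → Set ℓ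
  IsGraph V E = ∀ e → e ∈ E → e ∈[ V ]²

  -- The colours are the ordinals 0 = ∅ and 1 = {0}, and k = {0 , 1}.
  EDM : Set ℓ
  EDM =
    ∀ V E → IsGraph V E → Uncountable V →
    ∀ P → IsPairSet P V →
    ∀ c₀ c₁ k → IsEmpty c₀ → IsPair c₁ c₀ c₀ → IsPair k c₀ c₁ →
    ∀ f → IsFunction f P k →
      (∃ λ S → S ⊆ V × Uncountable S × Monochromatic f c₀ S)
    ⊎ (∃ λ S → S ⊆ V × CountablyInfinite S × Monochromatic f c₁ S)

  -- {X , Y} partitions [A]²; an empty part is allowed.
  IsPartition : Carrier → Carrier → Carrier → Set ℓ
  IsPartition A X Y =
    (∀ s → s ∈[ A ]² ⟷ (s ∈ X ⊎ s ∈ Y)) ×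
    (∀ s → ¬ (s ∈ X × s ∈ Y))

  RT : Set ℓ
  RT =
    ∀ A → Infinite A → ∀ X Y → IsPartition A X Y →
    ∃ λ B → B ⊆ A × Infinite B ×
      ((∀ s → s ∈[ B ]² → s ∈ X) ⊎ (∀ s → s ∈[ B ]² → s ∈ Y))

record IsZFModel {ℓ : Level} (𝓜 : Structure ℓ) : Set ℓ where
  open Structure 𝓜
  open SetTheory 𝓜
  field
    extensionality : ∀ x y → (∀ z → z ∈ x ⟷ z ∈ y) → x ≡ y
    foundation     : ∀ x → (∃ λ y → y ∈ x) →
                     ∃ λ y → y ∈ x × (∀ z → z ∈ x → ¬ (z ∈ y))
    pairing        : ∀ x y → ∃ λ u → IsPair u x y
    union          : ∀ x → ∃ λ u → ∀ z → z ∈ u ⟷ (∃ λ y → y ∈ x × z ∈ y)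
    powerset       : ∀ x → ∃ λ u → ∀ z → z ∈ u ⟷ z ⊆ x
    infinity       : ∃ λ w → Inductive w
    -- In both schemas ρ supplies the parameters of φ.
    separation     : ∀ {n} (φ : Formula (suc n)) (ρ : Vec Carrier n) a →
                     ∃ λ b → ∀ x → x ∈ b ⟷ (x ∈ a × Sat 𝓜 φ (x ∷ ρ))
    replacement    : ∀ {n} (φ : Formula (suc (suc n))) (ρ : Vec Carrier n) a →
                     (∀ x y y′ → x ∈ a → Sat 𝓜 φ (x ∷ y ∷ ρ) →
                       Sat 𝓜 φ (x ∷ y′ ∷ ρ) → y ≡ y′) →
                     ∃ λ b → ∀ y → y ∈ b ⟷ (∃ λ x → x ∈ a × Sat 𝓜 φ (x ∷ y ∷ ρ))

{-# OPTIONS --safe #-}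
module Submission where

-- If A is uncountable, EDM applied to the colouring X ↦ 0, Y ↦ 1 gives an
-- infinite homogeneous set of either colour.  If A is countable, ω well-orders
-- it, and infinite Ramsey holds in ZF: either some infinite B₀ ⊆ A has only
-- finite X-neighbourhoods (then in every infinite B ⊆ B₀ every point has an
-- infinite Y-neighbourhood), or every infinite B ⊆ A has a point whose
-- X-neighbourhood in B is infinite.  In both cases one iterates
-- B ↦ (neighbourhood in B of the least such point x of B), and the points x so
-- picked form an infinite homogeneous set.  Instead of a recursion on ω, the
-- stages B are the members of the least family closed under this map; it is a
-- chain by the Bourbaki–Witt argument.

open import Defs
open import Level using (Level)
open import Data.Nat using (ℕ; suc)
open import Data.Fin using (Fin; zero; suc)
open import Data.Vec using (Vec; []; _∷_)
open import Data.Product using (∃; _×_; _,_; proj₁; proj₂)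
open import Data.Sum using (_⊎_; inj₁; inj₂; [_,_]′; swap)
open import Function using (id; _∘_)
open import Relation.Nullary using (¬_; contradiction)
open import Relation.Binary.PropositionalEquality using (_≡_; _≢_; refl; sym; trans; subst)

-- First-order formulas for the set-theoretic notions

private
  variable
    n : ℕ

pattern v0 = zero
pattern v1 = suc v0
pattern v2 = suc v1
pattern v3 = suc v2
pattern v4 = suc v3
pattern v5 = suc v4
pattern v6 = suc v5

-- Each primed formula below unfolds under Sat, by computation alone, to the
-- unprimed predicate.

_⟷′_ : Formula n → Formula n → Formula n
φ ⟷′ ψ = (φ ⇒′ ψ) ∧′ (ψ ⇒′ φ)

_⊆′_ : Fin n → Fin n → Formula n
x ⊆′ y = ∀′ ((v0 ∈′ suc x) ⇒′ (v0 ∈′ suc y))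

isEmpty′ : Fin n → Formula n
isEmpty′ x = ∀′ (¬′ (v0 ∈′ suc x))

isPair′ isAdjunction′ isOrderedPair′ app′ : Fin n → Fin n → Fin n → Formula n
isPair′ u x y = ∀′ ((v0 ∈′ suc u) ⟷′ ((v0 ≡′ suc x) ∨′ (v0 ≡′ suc y)))
isAdjunction′ z y x = ∀′ ((v0 ∈′ suc z) ⟷′ ((v0 ∈′ suc y) ∨′ (v0 ≡′ suc x)))
isOrderedPair′ p x y =
  ∃′ (∃′ (isPair′ v1 (suc (suc x)) (suc (suc x)) ∧′
         (isPair′ v0 (suc (suc x)) (suc (suc y)) ∧′
          isPair′ (suc (suc p)) v1 v0)))
app′ x y f = ∃′ (isOrderedPair′ v0 (suc x) (suc y) ∧′ (v0 ∈′ suc f))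

inductive′ isOmega′ : Fin n → Formula n
inductive′ w =
  (∃′ (isEmpty′ v0 ∧′ (v0 ∈′ suc w))) ∧′
  (∀′ ((v0 ∈′ suc w) ⇒′ (∃′ (isAdjunction′ v0 v1 v1 ∧′ (v0 ∈′ suc (suc w))))))
isOmega′ w = inductive′ w ∧′ (∀′ (inductive′ v0 ⇒′ (suc w ⊆′ v0)))

isFunction′ isInjection′ isBijection′ : Fin n → Fin n → Fin n → Formula n
isFunction′ f X Y =
  (∀′ ((v0 ∈′ suc f) ⇒′
    (∃′ (∃′ ((v1 ∈′ suc (suc (suc X))) ∧′
            ((v0 ∈′ suc (suc (suc Y))) ∧′ isOrderedPair′ v2 v1 v0)))))) ∧′
  ((∀′ ((v0 ∈′ suc X) ⇒′ (∃′ (app′ v1 v0 (suc (suc f)))))) ∧′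
   (∀′ (∀′ (∀′ (app′ v2 v1 (suc (suc (suc f))) ⇒′
               (app′ v2 v0 (suc (suc (suc f))) ⇒′ (v1 ≡′ v0)))))))
isInjection′ f X Y =
  isFunction′ f X Y ∧′
  (∀′ (∀′ (∀′ (app′ v2 v0 (suc (suc (suc f))) ⇒′
              (app′ v1 v0 (suc (suc (suc f))) ⇒′ (v2 ≡′ v1))))))
isBijection′ f X Y =
  isInjection′ f X Y ∧′
  (∀′ ((v0 ∈′ suc Y) ⇒′ (∃′ (app′ v0 v1 (suc (suc f))))))

finite′ countable′ : Fin n → Formula n
finite′ X =
  ∃′ (isOmega′ v0 ∧′
    (∃′ ((v0 ∈′ v1) ∧′ (∃′ (isBijection′ v0 (suc (suc (suc X))) v1)))))
countable′ X = ∃′ (isOmega′ v0 ∧′ (∃′ (isInjection′ v0 (suc (suc X)) v1)))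

-- Classical reasoning and elementary set operations

module _ {ℓ : Level} (𝓜 : Structure ℓ) (classical : Classical 𝓜) (zf : IsZFModel 𝓜) where
  open Structure 𝓜
  open SetTheory 𝓜
  open IsZFModel zf

  -- Excluded middle holds only for satisfaction of formulas, so each classical argument must
  -- exhibit the formula it concerns.
  by-contradiction : (φ : Formula n) (ρ : Vec Carrier n) → ¬ ¬ Sat 𝓜 φ ρ → Sat 𝓜 φ ρ
  by-contradiction φ ρ ¬¬p with classical φ ρ
  ... | inj₁ p  = p
  ... | inj₂ ¬p = contradiction ¬p ¬¬p

  _≟_ : ∀ x y → x ≡ y ⊎ x ≢ y
  x ≟ y = classical (v0 ≡′ v1) (x ∷ y ∷ [])

  _∈?_ : ∀ x y → x ∈ y ⊎ ¬ (x ∈ y)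
  x ∈? y = classical (v0 ∈′ v1) (x ∷ y ∷ [])

  ⊆-antisym : ∀ {x y} → x ⊆ y → y ⊆ x → x ≡ y
  ⊆-antisym {x} {y} x⊆y y⊆x = extensionality x y λ z → x⊆y z , y⊆x z

  unique : ∀ {u v} {P : Carrier → Set ℓ} →
           (∀ z → z ∈ u ⟷ P z) → (∀ z → z ∈ v ⟷ P z) → u ≡ v
  unique p q = ⊆-antisym (λ z → proj₂ (q z) ∘ proj₁ (p z)) (λ z → proj₂ (p z) ∘ proj₁ (q z))

  empty-unique : ∀ {x y} → IsEmpty x → IsEmpty y → x ≡ y
  empty-unique p q = ⊆-antisym (λ z z∈x → contradiction z∈x (p z)) (λ z z∈y → contradiction z∈y (q z))

  -- Foundation applied to `{x}`, whose minimal element can only be `x`.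
  ∈-irrefl : ∀ {x} → ¬ (x ∈ x)
  ∈-irrefl {x} x∈x =
    let (s , s-spec) = pairing x x
        (y , y∈s , y-minimal) = foundation s (x , proj₂ (s-spec x) (inj₁ refl))
        y≡x = [ id , id ]′ (proj₁ (s-spec y) y∈s)
    in y-minimal x (proj₂ (s-spec x) (inj₁ refl)) (subst (x ∈_) (sym y≡x) x∈x)

  -- This is z = y ∪ {x}. For y = x it unfolds to `IsSuc z x`, so successors are a special case.
  IsAdjunction : Carrier → Carrier → Carrier → Set ℓ
  IsAdjunction z y x = ∀ u → u ∈ z ⟷ (u ∈ y ⊎ u ≡ x)

  union₂ : ∀ x y → ∃ λ u → ∀ z → z ∈ u ⟷ (z ∈ x ⊎ z ∈ y)
  union₂ x y =
    let (p , p-spec) = pairing x y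
        (u , u-spec) = union p
    in u , λ z →
      (λ z∈u → let (v , v∈p , z∈v) = proj₁ (u-spec z) z∈u in
        [ (λ v≡x → inj₁ (subst (z ∈_) v≡x z∈v)) , (λ v≡y → inj₂ (subst (z ∈_) v≡y z∈v)) ]′
          (proj₁ (p-spec v) v∈p)) ,
      [ (λ z∈x → proj₂ (u-spec z) (x , proj₂ (p-spec x) (inj₁ refl) , z∈x))
      , (λ z∈y → proj₂ (u-spec z) (y , proj₂ (p-spec y) (inj₂ refl) , z∈y)) ]′

  adjunction : ∀ y x → ∃ λ z → IsAdjunction z y x
  adjunction y x =
    let (s , s-spec) = pairing x x
        (z , z-spec) = union₂ y s
    in z , λ u →
      [ inj₁ , (λ u∈s → inj₂ ([ id , id ]′ (proj₁ (s-spec u) u∈s))) ]′ ∘ proj₁ (z-spec u) ,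
      [ (λ u∈y → proj₂ (z-spec u) (inj₁ u∈y))
      , (λ u≡x → proj₂ (z-spec u) (inj₂ (proj₂ (s-spec u) (inj₁ u≡x)))) ]′

  difference-singleton : ∀ Z x → ∃ λ Y → ∀ z → z ∈ Y ⟷ (z ∈ Z × z ≢ x)
  difference-singleton Z x = separation (¬′ (v0 ≡′ v1)) (x ∷ []) Z

  adjunction-difference : ∀ {Z Y x} → (∀ z → z ∈ Y ⟷ (z ∈ Z × z ≢ x)) → x ∈ Z → IsAdjunction Z Y x
  adjunction-difference {x = x} Y-spec x∈Z z =
    (λ z∈Z → [ inj₂ , (λ z≢x → inj₁ (proj₂ (Y-spec z) (z∈Z , z≢x))) ]′ (z ≟ x)) ,
    [ proj₁ ∘ proj₁ (Y-spec z) , (λ { refl → x∈Z }) ]′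

  adjunction-absorb : ∀ {Z Y x} → x ∈ Y → IsAdjunction Z Y x → Z ≡ Y
  adjunction-absorb x∈Y Z-spec =
    ⊆-antisym (λ z z∈Z → [ id , (λ { refl → x∈Y }) ]′ (proj₁ (Z-spec z) z∈Z))
              (λ z z∈Y → proj₂ (Z-spec z) (inj₁ z∈Y))

  -- Ordered pairs and functions

  IsPair-unique : ∀ {s t x y} → IsPair s x y → IsPair t x y → s ≡ t
  IsPair-unique = unique

  IsPair-sym : ∀ {s x y} → IsPair s x y → IsPair s y x
  IsPair-sym p z = swap ∘ proj₁ (p z) , proj₂ (p z) ∘ swap

  IsOrderedPair-exists : ∀ x y → ∃ λ p → IsOrderedPair p x y
  IsOrderedPair-exists x y =
    let (s , s-spec) = pairing x x
        (t , t-spec) = pairing x y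
        (p , p-spec) = pairing s t
    in p , s , t , s-spec , t-spec , p-spec

  IsOrderedPair-unique : ∀ {p q x y} → IsOrderedPair p x y → IsOrderedPair q x y → p ≡ q
  IsOrderedPair-unique (s , t , s-spec , t-spec , p-spec) (s′ , t′ , s′-spec , t′-spec , q-spec)
    with unique s-spec s′-spec | unique t-spec t′-spec
  ... | refl | refl = unique p-spec q-spec

  IsOrderedPair-injective : ∀ {p x y x′ y′} →
    IsOrderedPair p x y → IsOrderedPair p x′ y′ → x ≡ x′ × y ≡ y′
  IsOrderedPair-injective {p} {x} {y} {x′} {y′}
    (s , t , s-spec , t-spec , p-spec) (s′ , t′ , s′-spec , t′-spec , p-spec′) = x≡x′ , y≡y′
    where
    x≡x′ : x ≡ x′
    x≡x′ with proj₁ (p-spec′ s) (proj₂ (p-spec s) (inj₁ refl))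
    ... | inj₁ refl = [ id , id ]′ (proj₁ (s′-spec x) (proj₂ (s-spec x) (inj₁ refl)))
    ... | inj₂ refl = sym ([ id , id ]′ (proj₁ (s-spec x′) (proj₂ (t′-spec x′) (inj₁ refl))))

    same-second : t ≡ t′ → y ≡ y′
    same-second refl with proj₁ (t′-spec y) (proj₂ (t-spec y) (inj₂ refl))
    ... | inj₂ y≡y′ = y≡y′
    ... | inj₁ y≡x′ with proj₁ (t-spec y′) (proj₂ (t′-spec y′) (inj₂ refl))
    ...   | inj₁ y′≡x = trans y≡x′ (sym (trans y′≡x x≡x′))
    ...   | inj₂ y′≡y = sym y′≡y

    y≡y′ : y ≡ y′
    y≡y′ with proj₁ (p-spec′ t) (proj₂ (p-spec t) (inj₂ refl))
               | proj₁ (p-spec t′) (proj₂ (p-spec′ t′) (inj₂ refl))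
    ... | inj₂ t≡t′ | _         = same-second t≡t′
    ... | inj₁ _    | inj₂ t′≡t = same-second (sym t′≡t)
    -- The degenerate case {x, y} = {x′} and {x′, y′} = {x}: all four points coincide.
    ... | inj₁ refl | inj₁ refl =
      trans ([ id , id ]′ (proj₁ (s′-spec y) (proj₂ (t-spec y) (inj₂ refl))))
        (sym (trans ([ id , id ]′ (proj₁ (s-spec y′) (proj₂ (t′-spec y′) (inj₂ refl)))) x≡x′))

  app-bounds : ∀ {f X Y x y} → IsFunction f X Y → ⟨ x , y ⟩∈ f → x ∈ X × y ∈ Y
  app-bounds (total , _) (p , p-pair , p∈f) with total p p∈f
  ... | a , b , a∈X , b∈Y , p-pair′ with IsOrderedPair-injective p-pair p-pair′
  ...   | refl , refl = a∈X , b∈Y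

  app-adjunction : ∀ {g f p x y} → IsAdjunction g f p → IsOrderedPair p x y →
    ∀ {a b} → ⟨ a , b ⟩∈ g ⟷ (⟨ a , b ⟩∈ f ⊎ (a ≡ x × b ≡ y))
  app-adjunction g-spec p-pair {a} {b} = to , from
    where
    to : ⟨ a , b ⟩∈ _ → _
    to (q , q-pair , q∈g) with proj₁ (g-spec q) q∈g
    ... | inj₁ q∈f  = inj₁ (q , q-pair , q∈f)
    ... | inj₂ refl = inj₂ (IsOrderedPair-injective q-pair p-pair)

    from : _ → ⟨ a , b ⟩∈ _
    from (inj₁ (q , q-pair , q∈f)) = q , q-pair , proj₂ (g-spec q) (inj₁ q∈f)
    from (inj₂ (refl , refl))      = _ , p-pair , proj₂ (g-spec _) (inj₂ refl)

  -- The ordinal ω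

  -- Separation cuts the intersection of all inductive sets out of one of them. By extensionality
  -- the zero and the successors found in different inductive sets are the same.
  omega : ∃ IsOmega
  omega =
    let (v , v-inductive) = infinity
        (w , w-spec) = separation (∀′ (inductive′ v0 ⇒′ (v1 ∈′ v0))) [] v
        ((e , e-empty , _) , _) = v-inductive
    in w ,
       ( ( (e , e-empty , proj₂ (w-spec e)
             ( inductive-empty v-inductive e-empty
             , λ u u-inductive → inductive-empty u-inductive e-empty))
         , λ x x∈w →
             let (s , s-suc , s∈v) = proj₂ v-inductive x (proj₁ (proj₁ (w-spec x) x∈w))
             in s , s-suc , proj₂ (w-spec s)
                  (s∈v , λ u u-inductive →
                    inductive-suc u-inductive (proj₂ (proj₁ (w-spec x) x∈w) u u-inductive) s-suc))
       , λ u u-inductive x x∈w → proj₂ (proj₁ (w-spec x) x∈w) u u-inductive)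
    where
    inductive-empty : ∀ {u e} → Inductive u → IsEmpty e → e ∈ u
    inductive-empty ((e′ , e′-empty , e′∈u) , _) e-empty =
      subst (_∈ _) (empty-unique e′-empty e-empty) e′∈u

    inductive-suc : ∀ {u x s} → Inductive u → x ∈ u → IsSuc s x → s ∈ u
    inductive-suc {x = x} (_ , closed) x∈u s-suc =
      let (s′ , s′-suc , s′∈u) = closed x x∈u in subst (_∈ _) (unique s′-suc s-suc) s′∈u

  module Omega {w : Carrier} (isOmega : IsOmega w) where

    zero∈ω : ∀ {e} → IsEmpty e → e ∈ w
    zero∈ω e-empty =
      let ((e′ , e′-empty , e′∈w) , _) , _ = isOmega
      in subst (_∈ w) (empty-unique e′-empty e-empty) e′∈w

    suc∈ω : ∀ {m s} → m ∈ w → IsSuc s m → s ∈ w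
    suc∈ω {m} m∈w s-suc =
      let (s′ , s′-suc , s′∈w) = proj₂ (proj₁ isOmega) m m∈w
      in subst (_∈ w) (unique s′-suc s-suc) s′∈w

    -- The elements of ω satisfying φ form an inductive set, and ω is contained in every such set.
    -- Separation is why the property must be a formula.
    ω-induction : (φ : Formula (suc n)) (ρ : Vec Carrier n) →
      (∀ e → IsEmpty e → Sat 𝓜 φ (e ∷ ρ)) →
      (∀ m s → m ∈ w → IsSuc s m → Sat 𝓜 φ (m ∷ ρ) → Sat 𝓜 φ (s ∷ ρ)) →
      ∀ m → m ∈ w → Sat 𝓜 φ (m ∷ ρ)
    ω-induction φ ρ base step m m∈w =
      let (v , v-spec) = separation φ ρ w
          (e , e-empty , e∈w) , closed = proj₁ isOmega
          v-inductive = (e , e-empty , proj₂ (v-spec e) (e∈w , base e e-empty)) , λ x x∈v →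
            let (x∈w , φx) = proj₁ (v-spec x) x∈v
                (s , s-suc , s∈w) = closed x x∈w
            in s , s-suc , proj₂ (v-spec s) (s∈w , step x s x∈w s-suc φx)
      in proj₂ (proj₁ (v-spec m) (proj₂ isOmega v v-inductive m m∈w))

    ω-transitive : ∀ m → m ∈ w → m ⊆ w
    ω-transitive = ω-induction (v0 ⊆′ v1) (w ∷ [])
      (λ e e-empty z z∈e → contradiction z∈e (e-empty z))
      (λ m s m∈w s-suc m⊆w z z∈s → [ m⊆w z , (λ { refl → m∈w }) ]′ (proj₁ (s-suc z) z∈s))

    ∈-trans : ∀ m → m ∈ w → ∀ l → l ∈ m → l ⊆ m
    ∈-trans = ω-induction (∀′ ((v0 ∈′ v1) ⇒′ (v0 ⊆′ v1))) []
      (λ e e-empty l l∈e → contradiction l∈e (e-empty l))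
      (λ m s m∈w s-suc ih l l∈s k k∈l → proj₂ (s-suc k) (inj₁
        ([ (λ l∈m → ih l l∈m k k∈l) , (λ { refl → k∈l }) ]′ (proj₁ (s-suc l) l∈s))))

    -- Needed in the successor step of `∈-compare`, to pass from `l ∈ m` to a comparison of the
    -- successor of l with m.
    suc-≤ : ∀ m → m ∈ w → ∀ l → l ∈ m → ∀ s → IsSuc s l → s ∈ m ⊎ s ≡ m
    suc-≤ = ω-induction
      (∀′ ((v0 ∈′ v1) ⇒′ (∀′ (isAdjunction′ v0 v1 v1 ⇒′ ((v0 ∈′ v2) ∨′ (v0 ≡′ v2)))))) []
      (λ e e-empty l l∈e → contradiction l∈e (e-empty l))
      (λ m m⁺ m∈w m⁺-suc ih l l∈m⁺ s s-suc →
        [ (λ l∈m → inj₁ (proj₂ (m⁺-suc s) (ih l l∈m s s-suc)))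
        , (λ { refl → inj₂ (unique s-suc m⁺-suc) }) ]′ (proj₁ (m⁺-suc l) l∈m⁺))

    zero-≤ : ∀ {e} → IsEmpty e → ∀ m → m ∈ w → e ∈ m ⊎ e ≡ m
    zero-≤ {e} e-empty = ω-induction ((v1 ∈′ v0) ∨′ (v1 ≡′ v0)) (e ∷ [])
      (λ e′ e′-empty → inj₂ (empty-unique e-empty e′-empty))
      (λ m s m∈w s-suc e≤m → inj₁ (proj₂ (s-suc e) e≤m))

    ∈-compare : ∀ l → l ∈ w → ∀ m → m ∈ w → l ∈ m ⊎ (l ≡ m ⊎ m ∈ l)
    ∈-compare = ω-induction
      (∀′ ((v0 ∈′ v2) ⇒′ ((v1 ∈′ v0) ∨′ ((v1 ≡′ v0) ∨′ (v0 ∈′ v1))))) (w ∷ [])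
      (λ e e-empty m m∈w → [ inj₁ , inj₂ ∘ inj₁ ]′ (zero-≤ e-empty m m∈w))
      (λ l s l∈w s-suc ih m m∈w →
        [ (λ l∈m → [ inj₁ , inj₂ ∘ inj₁ ]′ (suc-≤ m m∈w l l∈m s s-suc))
        , (λ m≤l → inj₂ (inj₂ (proj₂ (s-suc m) (swap ([ inj₁ ∘ sym , inj₂ ]′ m≤l))))) ]′
        (ih m m∈w))

  -- Finite sets

  finite-empty : ∀ {X} → IsEmpty X → Finite X
  finite-empty {X} X-empty =
    let (w , isOmega) = omega
    in w , isOmega , X , Omega.zero∈ω isOmega X-empty , X ,
       (((λ p p∈X → contradiction p∈X (X-empty p)) ,
         (λ x x∈X → contradiction x∈X (X-empty x)) ,
         (λ { x y y′ (p , _ , p∈X) → contradiction p∈X (X-empty p) })) ,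
        (λ { x x′ y (p , _ , p∈X) → contradiction p∈X (X-empty p) })) ,
       (λ x x∈X → contradiction x∈X (X-empty x))

  -- If x is new, adding ⟨x, m⟩ to the bijection onto m gives a bijection onto m ∪ {m}; it stays
  -- injective because m ∉ m.
  finite-adjunction : ∀ {Z Y x} → IsAdjunction Z Y x → Finite Y → Finite Z
  finite-adjunction {Z} {Y} {x} Z-spec Y-finite@(w , isOmega , m , m∈w , f , ((f-fun , f-inj) , f-surj))
    with x ∈? Y
  ... | inj₁ x∈Y = subst Finite (sym (adjunction-absorb x∈Y Z-spec)) Y-finite
  ... | inj₂ x∉Y =
    w , isOmega , m⁺ , Omega.suc∈ω isOmega m∈w m⁺-suc , g , ((g-bounds , g-total , g-functional) , g-injective) , g-surjective
    where
    m⁺ = proj₁ (adjunction m m)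
    m⁺-suc = proj₂ (adjunction m m)
    p = proj₁ (IsOrderedPair-exists x m)
    p-pair = proj₂ (IsOrderedPair-exists x m)
    g = proj₁ (adjunction f p)
    g-spec = proj₂ (adjunction f p)

    app-g : ∀ {a b} → ⟨ a , b ⟩∈ g ⟷ (⟨ a , b ⟩∈ f ⊎ (a ≡ x × b ≡ m))
    app-g = app-adjunction g-spec p-pair

    g-bounds : ∀ q → q ∈ g → ∃ λ a → ∃ λ b → a ∈ Z × b ∈ m⁺ × IsOrderedPair q a b
    g-bounds q q∈g with proj₁ (g-spec q) q∈g
    ... | inj₂ refl = x , m , proj₂ (Z-spec x) (inj₂ refl) , proj₂ (m⁺-suc m) (inj₂ refl) , p-pair
    ... | inj₁ q∈f  =
      let (a , b , a∈Y , b∈m , q-pair) = proj₁ f-fun q q∈f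
      in a , b , proj₂ (Z-spec a) (inj₁ a∈Y) , proj₂ (m⁺-suc b) (inj₁ b∈m) , q-pair

    g-total : ∀ a → a ∈ Z → ∃ λ b → ⟨ a , b ⟩∈ g
    g-total a a∈Z with proj₁ (Z-spec a) a∈Z
    ... | inj₁ a∈Y = let (b , ab∈f) = proj₁ (proj₂ f-fun) a a∈Y in b , proj₂ app-g (inj₁ ab∈f)
    ... | inj₂ a≡x = m , proj₂ app-g (inj₂ (a≡x , refl))

    g-functional : ∀ a b b′ → ⟨ a , b ⟩∈ g → ⟨ a , b′ ⟩∈ g → b ≡ b′
    g-functional a b b′ ab∈g ab′∈g with proj₁ app-g ab∈g | proj₁ app-g ab′∈g
    ... | inj₁ ab∈f          | inj₁ ab′∈f         = proj₂ (proj₂ f-fun) a b b′ ab∈f ab′∈f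
    ... | inj₁ ab∈f          | inj₂ (refl , refl) = contradiction (proj₁ (app-bounds f-fun ab∈f)) x∉Y
    ... | inj₂ (refl , refl) | inj₁ ab′∈f         = contradiction (proj₁ (app-bounds f-fun ab′∈f)) x∉Y
    ... | inj₂ (refl , refl) | inj₂ (refl , refl) = refl

    g-injective : ∀ a a′ b → ⟨ a , b ⟩∈ g → ⟨ a′ , b ⟩∈ g → a ≡ a′
    g-injective a a′ b ab∈g a′b∈g with proj₁ app-g ab∈g | proj₁ app-g a′b∈g
    ... | inj₁ ab∈f          | inj₁ a′b∈f         = f-inj a a′ b ab∈f a′b∈f
    ... | inj₁ ab∈f          | inj₂ (refl , refl) = contradiction (proj₂ (app-bounds f-fun ab∈f)) ∈-irrefl
    ... | inj₂ (refl , refl) | inj₁ a′b∈f         = contradiction (proj₂ (app-bounds f-fun a′b∈f)) ∈-irrefl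
    ... | inj₂ (refl , refl) | inj₂ (refl , refl) = refl

    g-surjective : ∀ b → b ∈ m⁺ → ∃ λ a → ⟨ a , b ⟩∈ g
    g-surjective b b∈m⁺ with proj₁ (m⁺-suc b) b∈m⁺
    ... | inj₁ b∈m = let (a , ab∈f) = f-surj b b∈m in a , proj₂ app-g (inj₁ ab∈f)
    ... | inj₂ b≡m = x , proj₂ app-g (inj₂ (refl , b≡m))

  -- Kuratowski's form of finiteness. The induction on k proves `D ∈ T` for all D ⊆ X that f maps
  -- into k. In the successor step the point of D with value k, if there is one, is removed;
  -- injectivity of f sends the others into k.
  finite-closure : ∀ {X} → Finite X → ∀ T →
    (∀ e → IsEmpty e → e ∈ T) →
    (∀ Y x Z → Y ∈ T → x ∈ X → IsAdjunction Z Y x → Z ∈ T) →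
    X ∈ T
  finite-closure {X} (w , isOmega , m , m∈w , f , ((f-fun , f-inj) , _)) T base step =
    Omega.ω-induction isOmega
      (∀′ ((v0 ⊆′ v3) ⇒′
        ((∀′ ((v0 ∈′ v1) ⇒′ (∃′ ((v0 ∈′ v3) ∧′ app′ v1 v0 v6)))) ⇒′ (v0 ∈′ v2))))
      (T ∷ X ∷ f ∷ [])
      (λ e e-empty D _ D↦e → base D λ x x∈D →
        let (y , y∈e , _) = D↦e x x∈D in e-empty y y∈e)
      successor m m∈w X (λ _ → id)
      (λ x x∈X → let (y , xy∈f) = proj₁ (proj₂ f-fun) x x∈X
                 in y , proj₂ (app-bounds f-fun xy∈f) , xy∈f)
    where
    Maps-into : Carrier → Carrier → Set ℓ
    Maps-into D k = ∀ x → x ∈ D → ∃ λ y → y ∈ k × ⟨ x , y ⟩∈ f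

    successor : ∀ k s → k ∈ w → IsSuc s k →
      (∀ D → D ⊆ X → Maps-into D k → D ∈ T) → ∀ D → D ⊆ X → Maps-into D s → D ∈ T
    successor k s k∈w s-suc ih D D⊆X D↦s
      with classical (∃′ ((v0 ∈′ v1) ∧′ app′ v0 v2 v3)) (D ∷ k ∷ f ∷ [])
    ... | inj₂ avoids = ih D D⊆X λ x x∈D →
      let (y , y∈s , xy∈f) = D↦s x x∈D
      in y , [ id , (λ { refl → contradiction (x , x∈D , xy∈f) avoids }) ]′ (proj₁ (s-suc y) y∈s) , xy∈f
    ... | inj₁ (d , d∈D , dk∈f) =
      let (D′ , D′-spec) = difference-singleton D d
          D′∈T = ih D′ (λ x x∈D′ → D⊆X x (proj₁ (proj₁ (D′-spec x) x∈D′))) λ x x∈D′ →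
            let (x∈D , x≢d) = proj₁ (D′-spec x) x∈D′
                (y , y∈s , xy∈f) = D↦s x x∈D
            in y , [ id , (λ { refl → contradiction (f-inj x d y xy∈f dk∈f) x≢d }) ]′
                     (proj₁ (s-suc y) y∈s) , xy∈f
      in step D′ d D D′∈T (D⊆X d d∈D) (adjunction-difference D′-spec d∈D)

  -- `finite-closure` for the family of subsets of X that satisfy φ, a set by powerset and
  -- separation.
  finite-induction : (φ : Formula (suc n)) (ρ : Vec Carrier n) → ∀ {X} → Finite X →
    (∀ e → IsEmpty e → Sat 𝓜 φ (e ∷ ρ)) →
    (∀ Y x Z → x ∈ X → IsAdjunction Z Y x → Sat 𝓜 φ (Y ∷ ρ) → Sat 𝓜 φ (Z ∷ ρ)) →
    Sat 𝓜 φ (X ∷ ρ)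
  finite-induction φ ρ {X} X-finite base step =
    let (P , P-spec) = powerset X
        (T , T-spec) = separation φ ρ P
    in proj₂ (proj₁ (T-spec X) (finite-closure X-finite T
         (λ e e-empty → proj₂ (T-spec e)
           (proj₂ (P-spec e) (λ z z∈e → contradiction z∈e (e-empty z)) , base e e-empty))
         (λ Y x Z Y∈T x∈X Z-spec →
           let (Y∈P , φY) = proj₁ (T-spec Y) Y∈T
           in proj₂ (T-spec Z)
                ( proj₂ (P-spec Z) (λ z z∈Z →
                    [ proj₁ (P-spec Y) Y∈P z , (λ { refl → x∈X }) ]′ (proj₁ (Z-spec z) z∈Z))
                , step Y x Z x∈X Z-spec φY))))

  finite-difference : ∀ {Z Y x} → (∀ z → z ∈ Y ⟷ (z ∈ Z × z ≢ x)) → Finite Y → Finite Z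
  finite-difference {Z} {Y} {x} Y-spec Y-finite with x ∈? Z
  ... | inj₁ x∈Z = finite-adjunction (adjunction-difference Y-spec x∈Z) Y-finite
  ... | inj₂ x∉Z = subst Finite
    (⊆-antisym (λ z z∈Y → proj₁ (proj₁ (Y-spec z) z∈Y))
               (λ z z∈Z → proj₂ (Y-spec z) (z∈Z , λ { refl → x∉Z z∈Z })))
    Y-finite

  -- Induction on X: deleting from Z the point last adjoined leaves a set covered by the previous
  -- stage and Y. The hypothesis speaks of all subsets of Y because `finite-⊆` is itself derived
  -- from this lemma, with Y empty.
  finite-cover-induction : ∀ {X Y} → Finite X → (∀ Z → Z ⊆ Y → Finite Z) →
    ∀ Z → (∀ z → z ∈ Z → z ∈ X ⊎ z ∈ Y) → Finite Z
  finite-cover-induction {X} {Y} X-finite Y-subsets = finite-induction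
    (∀′ ((∀′ ((v0 ∈′ v1) ⇒′ ((v0 ∈′ v2) ∨′ (v0 ∈′ v3)))) ⇒′ finite′ v0)) (Y ∷ []) X-finite
    (λ e e-empty Z Z⊆ → Y-subsets Z λ z z∈Z →
      [ (λ z∈e → contradiction z∈e (e-empty z)) , id ]′ (Z⊆ z z∈Z))
    (λ D x D⁺ _ D⁺-spec ih Z Z⊆ →
      let (Z⁻ , Z⁻-spec) = difference-singleton Z x
      in finite-difference Z⁻-spec (ih Z⁻ λ z z∈Z⁻ →
           let (z∈Z , z≢x) = proj₁ (Z⁻-spec z) z∈Z⁻
           in [ (λ z∈D⁺ → inj₁ ([ id , (λ z≡x → contradiction z≡x z≢x) ]′ (proj₁ (D⁺-spec z) z∈D⁺)))
              , inj₂ ]′ (Z⊆ z z∈Z)))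

  finite-⊆ : ∀ {X Z} → Finite X → Z ⊆ X → Finite Z
  finite-⊆ {X} {Z} X-finite Z⊆X =
    let ((e , e-empty , _) , _) , _ = proj₂ omega
    in finite-cover-induction X-finite
         (λ S S⊆e → finite-empty (λ z z∈S → e-empty z (S⊆e z z∈S))) Z
         (λ z z∈Z → inj₁ (Z⊆X z z∈Z))

  finite-cover : ∀ {X Y Z} → Finite X → Finite Y → (∀ z → z ∈ Z → z ∈ X ⊎ z ∈ Y) → Finite Z
  finite-cover X-finite Y-finite = finite-cover-induction X-finite (λ S → finite-⊆ Y-finite) _

  infinite-inhabited : ∀ {X} → Infinite X → ∃ λ x → x ∈ X
  infinite-inhabited {X} X-infinite = by-contradiction (∃′ (v0 ∈′ v1)) (X ∷ [])
    λ none → X-infinite (finite-empty λ x x∈X → none (x , x∈X))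

  finite⇒countable : ∀ {X} → Finite X → Countable X
  finite⇒countable (w , isOmega , m , m∈w , f , (((f-bounds , f-rest) , f-inj) , _)) =
    w , isOmega , f ,
    ((λ p p∈f → let (x , y , x∈X , y∈m , p-pair) = f-bounds p p∈f
                in x , y , x∈X , Omega.ω-transitive isOmega m m∈w y y∈m , p-pair) , f-rest) ,
    f-inj

  -- Induction on X: for a new point with value v, the bound m is kept if v ∈ m and is replaced by
  -- the successor of v otherwise.
  finite-bounded : ∀ {w f X} → IsOmega w → IsFunction f X w → Finite X →
    ∃ λ m → m ∈ w × (∀ x → x ∈ X → ∀ y → ⟨ x , y ⟩∈ f → y ∈ m)
  finite-bounded {w} {f} isOmega f-fun X-finite = finite-induction
    (∃′ ((v0 ∈′ v2) ∧′ (∀′ ((v0 ∈′ v2) ⇒′ (∀′ (app′ v1 v0 v5 ⇒′ (v0 ∈′ v2)))))))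
    (w ∷ f ∷ []) X-finite
    -- Any number bounds the values on the empty set; zero is at hand.
    (λ e e-empty → let ((z , _ , z∈w) , _) , _ = isOmega
                   in z , z∈w , λ x x∈e → contradiction x∈e (e-empty x))
    adjoin
    where
    open Omega isOmega

    Bounds : Carrier → Carrier → Set ℓ
    Bounds m D = ∀ x → x ∈ D → ∀ y → ⟨ x , y ⟩∈ f → y ∈ m

    adjoin : ∀ D d D⁺ → d ∈ _ → IsAdjunction D⁺ D d →
      (∃ λ m → m ∈ w × Bounds m D) → ∃ λ m → m ∈ w × Bounds m D⁺
    adjoin D d D⁺ d∈X D⁺-spec (m , m∈w , m-bounds) = bound (∈-compare v v∈w m m∈w)
      where
      v = proj₁ (proj₁ (proj₂ f-fun) d d∈X)
      dv∈f = proj₂ (proj₁ (proj₂ f-fun) d d∈X)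
      v∈w = proj₂ (app-bounds f-fun dv∈f)
      s = proj₁ (adjunction v v)
      s-suc = proj₂ (adjunction v v)

      extend : ∀ k → v ∈ k → m ⊆ k → Bounds k D⁺
      extend k v∈k m⊆k x x∈D⁺ y xy∈f with proj₁ (D⁺-spec x) x∈D⁺
      ... | inj₁ x∈D  = m⊆k y (m-bounds x x∈D y xy∈f)
      ... | inj₂ refl = subst (_∈ k) (proj₂ (proj₂ f-fun) x v y dv∈f xy∈f) v∈k

      bound : v ∈ m ⊎ (v ≡ m ⊎ m ∈ v) → ∃ λ k → k ∈ w × Bounds k D⁺
      bound (inj₁ v∈m) = m , m∈w , extend m v∈m (λ _ → id)
      bound (inj₂ m≤v) = s , suc∈ω v∈w s-suc ,
        extend s (proj₂ (s-suc v) (inj₂ refl)) λ y y∈m → proj₂ (s-suc y) (inj₁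
          ([ (λ { refl → y∈m }) , (λ m∈v → ∈-trans v v∈w m m∈v y y∈m) ]′ m≤v))

  uncountable⇒infinite : ∀ {X} → Uncountable X → Infinite X
  uncountable⇒infinite X-uncountable = X-uncountable ∘ finite⇒countable

  -- A strict bound m on the values would itself be a value, whence m ∈ m.
  countablyInfinite⇒infinite : ∀ {X} → CountablyInfinite X → Infinite X
  countablyInfinite⇒infinite (w , isOmega , f , ((f-fun , _) , f-surj)) X-finite =
    let (m , m∈w , m-bounds) = finite-bounded isOmega f-fun X-finite
        (x , xm∈f) = f-surj m m∈w
    in ∈-irrefl (m-bounds x (proj₁ (app-bounds f-fun xm∈f)) m xm∈f)

  -- Ramsey's theorem for countable sets

  -- A set R of unordered pairs is read as a graph; R will be X or Y.
  Edge : Carrier → Carrier → Carrier → Set ℓ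
  Edge R x y = ∃ λ s → IsPair s x y × s ∈ R

  Edge-sym : ∀ {R x y} → Edge R x y → Edge R y x
  Edge-sym (s , s-pair , s∈R) = s , IsPair-sym s-pair , s∈R

  edge′ : Fin n → Fin n → Fin n → Formula n
  edge′ R x y = ∃′ (isPair′ v0 (suc x) (suc y) ∧′ (v0 ∈′ suc R))

  IsNeighbourhood : Carrier → Carrier → Carrier → Carrier → Set ℓ
  IsNeighbourhood R N B x = ∀ y → y ∈ N ⟷ (y ∈ B × Edge R x y)

  isNeighbourhood′ : Fin n → Fin n → Fin n → Fin n → Formula n
  isNeighbourhood′ R N B x =
    ∀′ ((v0 ∈′ suc N) ⟷′ ((v0 ∈′ suc B) ∧′ edge′ (suc R) (suc x) v0))

  neighbourhood : ∀ R B x → ∃ λ N → IsNeighbourhood R N B x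
  neighbourhood R B x = separation (edge′ v1 v2 v0) (R ∷ x ∷ []) B

  -- From such a point the construction can go on: restricting B to the neighbours of x leaves an
  -- infinite set.
  Rich : Carrier → Carrier → Carrier → Set ℓ
  Rich R B x = ∃ λ N → IsNeighbourhood R N B x × Infinite N

  rich′ : Fin n → Fin n → Fin n → Formula n
  rich′ R B x = ∃′ (isNeighbourhood′ (suc R) v0 (suc B) (suc x) ∧′ (¬′ (finite′ v0)))

  -- The order pulled back from ω along j; taking least points in it makes choice unnecessary.
  Precedes : Carrier → Carrier → Carrier → Set ℓ
  Precedes j x y = ∃ λ k → ∃ λ m → ⟨ x , k ⟩∈ j × ⟨ y , m ⟩∈ j × k ∈ m

  precedes′ : Fin n → Fin n → Fin n → Formula n
  precedes′ j x y =
    ∃′ (∃′ (app′ (suc (suc x)) v1 (suc (suc j)) ∧′ (app′ (suc (suc y)) v0 (suc (suc j)) ∧′ (v1 ∈′ v0))))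

  -- The well-order of an enumerated set

  module Enumerated {A w j : Carrier} (isOmega : IsOmega w) (isInjection : IsInjection j A w) where
    j-fun = proj₁ isInjection

    precedes-compare : ∀ x y → x ∈ A → y ∈ A → Precedes j x y ⊎ (x ≡ y ⊎ Precedes j y x)
    precedes-compare x y x∈A y∈A =
      let (k , xk∈j) = proj₁ (proj₂ j-fun) x x∈A
          (m , ym∈j) = proj₁ (proj₂ j-fun) y y∈A
      in [ (λ k∈m → inj₁ (k , m , xk∈j , ym∈j , k∈m))
         , [ (λ k≡m → inj₂ (inj₁ (proj₂ isInjection x y k xk∈j
                (subst (λ v → ⟨ y , v ⟩∈ j) (sym k≡m) ym∈j))))
           , (λ m∈k → inj₂ (inj₂ (m , k , ym∈j , xk∈j , m∈k))) ]′ ]′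
         (Omega.∈-compare isOmega k (proj₂ (app-bounds j-fun xk∈j)) m (proj₂ (app-bounds j-fun ym∈j)))

    -- Foundation applied to the set I of indices of points of B satisfying φ; a point with
    -- ∈-minimal index is least.
    precedes-least : (φ : Formula (suc n)) (ρ : Vec Carrier n) → ∀ B → B ⊆ A →
      (∃ λ x → x ∈ B × Sat 𝓜 φ (x ∷ ρ)) →
      ∃ λ x → x ∈ B × Sat 𝓜 φ (x ∷ ρ) × (∀ y → y ∈ B → Sat 𝓜 φ (y ∷ ρ) → ¬ Precedes j y x)
    precedes-least φ ρ B B⊆A (a , a∈B , φa) =
      let (S , S-spec) = separation φ ρ B
          (I , I-spec) = separation (∃′ ((v0 ∈′ v2) ∧′ app′ v0 v1 v3)) (S ∷ j ∷ []) w
          (k , ak∈j) = proj₁ (proj₂ j-fun) a (B⊆A a a∈B)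
          (m , m∈I , m-minimal) = foundation I
            (k , proj₂ (I-spec k) (proj₂ (app-bounds j-fun ak∈j) , a , proj₂ (S-spec a) (a∈B , φa) , ak∈j))
          (_ , x , x∈S , xm∈j) = proj₁ (I-spec m) m∈I
          (x∈B , φx) = proj₁ (S-spec x) x∈S
      in x , x∈B , φx , λ { y y∈B φy (l , m′ , yl∈j , xm′∈j , l∈m′) →
           m-minimal l
             (proj₂ (I-spec l) (proj₂ (app-bounds j-fun yl∈j) , y , proj₂ (S-spec y) (y∈B , φy) , yl∈j))
             (subst (l ∈_) (proj₂ (proj₂ j-fun) x m′ m xm′∈j xm∈j) l∈m′) }

    -- The tower of stages

    module Homogeneous {B₀ R : Carrier} (B₀⊆A : B₀ ⊆ A) (B₀-infinite : Infinite B₀)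
      (R-irrefl : ∀ x → ¬ Edge R x x)
      (rich-exists : ∀ B → B ⊆ B₀ → Infinite B → ∃ λ x → x ∈ B × Rich R B x) where

      -- The last clause makes x the least rich point of B, so that each stage determines its point.
      Pick : Carrier → Carrier → Set ℓ
      Pick B x = x ∈ B × Rich R B x × (∀ y → y ∈ B → Rich R B y → ¬ Precedes j y x)

      pick′ : Fin n → Fin n → Fin n → Fin n → Formula n
      pick′ R j B x =
        (x ∈′ B) ∧′ (rich′ R B x ∧′
          (∀′ ((v0 ∈′ suc B) ⇒′ (rich′ (suc R) (suc B) v0 ⇒′ (¬′ (precedes′ (suc j) v0 (suc x)))))))

      Next : Carrier → Carrier → Set ℓ
      Next B B′ = ∃ λ x → Pick B x × IsNeighbourhood R B′ B x

      next′ : Fin n → Fin n → Fin n → Fin n → Formula n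
      next′ R j B B′ =
        ∃′ (pick′ (suc R) (suc j) (suc B) v0 ∧′ isNeighbourhood′ (suc R) (suc B′) (suc B) v0)

      Closed : Carrier → Set ℓ
      Closed T = B₀ ∈ T × (∀ B B′ → B ∈ T → Next B B′ → B′ ∈ T)

      -- The quantifier over all closed T is first-order, so separation yields the least closed
      -- family. Bounding it by the powerset of B₀ is harmless, since passing to a next stage only
      -- shrinks a set.
      tower-comprehension : ∃ λ 𝓣 → ∀ B → B ∈ 𝓣 ⟷ (B ∈ proj₁ (powerset B₀) × (∀ T → Closed T → B ∈ T))
      tower-comprehension = separation
        (∀′ (((v2 ∈′ v0) ∧′ (∀′ (∀′ ((v1 ∈′ v2) ⇒′ (next′ v5 v6 v1 v0 ⇒′ (v0 ∈′ v2)))))) ⇒′ (v1 ∈′ v0)))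
        (B₀ ∷ R ∷ j ∷ []) (proj₁ (powerset B₀))

      𝓣 = proj₁ tower-comprehension

      𝓣-spec : ∀ B → B ∈ 𝓣 ⟷ (B ∈ proj₁ (powerset B₀) × (∀ T → Closed T → B ∈ T))
      𝓣-spec = proj₂ tower-comprehension

      stage⊆B₀ : ∀ {B} → B ∈ 𝓣 → B ⊆ B₀
      stage⊆B₀ {B} B∈𝓣 = proj₁ (proj₂ (powerset B₀) B) (proj₁ (proj₁ (𝓣-spec B) B∈𝓣))

      next⊆ : ∀ {B B′} → Next B B′ → B′ ⊆ B
      next⊆ (_ , _ , B′-spec) y y∈B′ = proj₁ (proj₁ (B′-spec y) y∈B′)

      B₀∈𝓣 : B₀ ∈ 𝓣
      B₀∈𝓣 = proj₂ (𝓣-spec B₀) (proj₂ (proj₂ (powerset B₀) B₀) (λ _ → id) , λ T → proj₁)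

      next∈𝓣 : ∀ {B B′} → B ∈ 𝓣 → Next B B′ → B′ ∈ 𝓣
      next∈𝓣 {B} {B′} B∈𝓣 next = proj₂ (𝓣-spec B′)
        ( proj₂ (proj₂ (powerset B₀) B′) (λ y y∈B′ → stage⊆B₀ B∈𝓣 y (next⊆ next y y∈B′))
        , λ T T-closed → proj₂ T-closed B B′ (proj₂ (proj₁ (𝓣-spec B) B∈𝓣) T T-closed) next)

      tower-induction : (φ : Formula (suc n)) (ρ : Vec Carrier n) →
        Sat 𝓜 φ (B₀ ∷ ρ) →
        (∀ B B′ → B ∈ 𝓣 → Next B B′ → Sat 𝓜 φ (B ∷ ρ) → Sat 𝓜 φ (B′ ∷ ρ)) →
        ∀ B → B ∈ 𝓣 → Sat 𝓜 φ (B ∷ ρ)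
      tower-induction φ ρ base step B B∈𝓣 =
        let (T , T-spec) = separation φ ρ 𝓣
        in proj₂ (proj₁ (T-spec B) (proj₂ (proj₁ (𝓣-spec B) B∈𝓣) T
             ( proj₂ (T-spec B₀) (B₀∈𝓣 , base)
             , λ C C′ C∈T next →
                 let (C∈𝓣 , φC) = proj₁ (T-spec C) C∈T
                 in proj₂ (T-spec C′) (next∈𝓣 C∈𝓣 next , step C C′ C∈𝓣 next φC))))

      -- A next stage is the neighbourhood of a rich point.
      stage-infinite : ∀ B → B ∈ 𝓣 → Infinite B
      stage-infinite = tower-induction (¬′ (finite′ v0)) [] B₀-infinite
        λ { B B′ B∈𝓣 (x , (_ , (N , N-spec , N-infinite) , _) , B′-spec) _ →
            subst Infinite (unique N-spec B′-spec) N-infinite }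

      pick-exists : ∀ B → B ∈ 𝓣 → ∃ λ x → Pick B x
      pick-exists B B∈𝓣 = precedes-least (rich′ v1 v2 v0) (R ∷ B ∷ []) B
        (λ z z∈B → B₀⊆A z (stage⊆B₀ B∈𝓣 z z∈B))
        (rich-exists B (stage⊆B₀ B∈𝓣) (stage-infinite B B∈𝓣))

      pick-unique : ∀ {B x y} → B ∈ 𝓣 → Pick B x → Pick B y → x ≡ y
      pick-unique {B} {x} {y} B∈𝓣 (x∈B , x-rich , x-minimal) (y∈B , y-rich , y-minimal) =
        [ (λ x≺y → contradiction x≺y (y-minimal x x∈B x-rich))
        , [ id , (λ y≺x → contradiction y≺x (x-minimal y y∈B y-rich)) ]′ ]′
        (precedes-compare x y (B₀⊆A x (stage⊆B₀ B∈𝓣 x x∈B)) (B₀⊆A y (stage⊆B₀ B∈𝓣 y y∈B)))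

      next-exists : ∀ {B x} → Pick B x → ∃ λ B′ → Next B B′
      next-exists {B} {x} x-pick =
        let (B′ , B′-spec) = neighbourhood R B x in B′ , x , x-pick , B′-spec

      next-edge : ∀ {B B′ x y} → B ∈ 𝓣 → Pick B x → Next B B′ → y ∈ B′ → Edge R x y
      next-edge {y = y} B∈𝓣 x-pick (x′ , x′-pick , B′-spec) y∈B′ =
        subst (λ v → Edge R v y) (pick-unique B∈𝓣 x′-pick x-pick) (proj₂ (proj₁ (B′-spec y) y∈B′))

      next-unique : ∀ {B C D} → B ∈ 𝓣 → Next B C → Next B D → C ≡ D
      next-unique {B} {C} {D} B∈𝓣 (x , x-pick , C-spec) (y , y-pick , D-spec) =
        unique C-spec (subst (IsNeighbourhood R D B) (pick-unique B∈𝓣 y-pick x-pick) D-spec)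

      -- The Bourbaki–Witt notion of an extreme point, for reverse inclusion.
      Extreme : Carrier → Set ℓ
      Extreme F = ∀ G → G ∈ 𝓣 → F ⊆ G → G ≡ F ⊎ (∀ G′ → Next G G′ → F ⊆ G′)

      -- Induction on G. While G properly contains F, extremality keeps the next stage above F; at G
      -- = F the next stage is that of F; from then on stages only shrink.
      extreme-compare : ∀ {F} → F ∈ 𝓣 → Extreme F →
        ∀ G → G ∈ 𝓣 → F ⊆ G ⊎ (∀ F′ → Next F F′ → G ⊆ F′)
      extreme-compare {F} F∈𝓣 F-extreme = tower-induction
        ((v1 ⊆′ v0) ∨′ (∀′ (next′ v3 v4 v2 v0 ⇒′ (v1 ⊆′ v0)))) (F ∷ R ∷ j ∷ [])
        (inj₁ (stage⊆B₀ F∈𝓣))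
        λ G G′ G∈𝓣 G-next →
          [ (λ F⊆G → [ (λ { refl → inj₂ λ F′ F-next →
                           subst (G′ ⊆_) (next-unique G∈𝓣 G-next F-next) (λ _ → id) })
                     , (λ F⊆next → inj₁ (F⊆next G′ G-next)) ]′ (F-extreme G G∈𝓣 F⊆G))
          , (λ G⊆next → inj₂ λ F′ F-next z z∈G′ → G⊆next F′ F-next z (next⊆ G-next z z∈G′)) ]′

      -- Induction on F. For G above the next stage F′, `extreme-compare` leaves three cases: G = F,
      -- whose next stage is F′; F inside the next stage of G, which then contains F′ ⊆ F; and G ⊆
      -- F′, so that G = F′.
      stage-extreme : ∀ F → F ∈ 𝓣 → Extreme F
      stage-extreme = tower-induction
        (∀′ ((v0 ∈′ v2) ⇒′ ((v1 ⊆′ v0) ⇒′ ((v0 ≡′ v1) ∨′ (∀′ (next′ v4 v5 v1 v0 ⇒′ (v2 ⊆′ v0)))))))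
        (𝓣 ∷ R ∷ j ∷ [])
        (λ G G∈𝓣 B₀⊆G → inj₁ (⊆-antisym (stage⊆B₀ G∈𝓣) B₀⊆G))
        λ F F′ F∈𝓣 F-next F-extreme G G∈𝓣 F′⊆G →
          [ (λ F⊆G → [ (λ { refl → inj₂ λ G′ G-next →
                           subst (F′ ⊆_) (next-unique F∈𝓣 F-next G-next) (λ _ → id) })
                     , (λ F⊆next → inj₂ λ G′ G-next z z∈F′ → F⊆next G′ G-next z (next⊆ F-next z z∈F′)) ]′
                     (F-extreme G G∈𝓣 F⊆G))
          , (λ G⊆next → inj₁ (⊆-antisym (G⊆next F′ F-next) F′⊆G)) ]′
          (extreme-compare F∈𝓣 F-extreme G G∈𝓣)

      -- More than a chain condition: a stage not above F already lies inside the next stage of F,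
      -- hence among the neighbours of the point picked from F.
      stage-compare : ∀ F → F ∈ 𝓣 → ∀ G → G ∈ 𝓣 → F ⊆ G ⊎ (∀ F′ → Next F F′ → G ⊆ F′)
      stage-compare F F∈𝓣 = extreme-compare F∈𝓣 (stage-extreme F F∈𝓣)

      -- The picked points: homogeneous and infinite

      Picked : Carrier → Set ℓ
      Picked x = ∃ λ B → B ∈ 𝓣 × Pick B x

      later-edge : ∀ {B C x y} → B ∈ 𝓣 → Pick B x →
        (∀ B′ → Next B B′ → C ⊆ B′) → y ∈ C → Edge R x y
      later-edge {y = y} B∈𝓣 x-pick C⊆next y∈C =
        let (B′ , B-next) = next-exists x-pick
        in next-edge B∈𝓣 x-pick B-next (C⊆next B′ B-next y y∈C)

      -- The point of the earlier stage is joined to every point of the later one, and equal stages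
      -- would pick equal points.
      picked-edge : ∀ {x y} → Picked x → Picked y → x ≢ y → Edge R x y
      picked-edge {x} {y} (B , B∈𝓣 , x-pick) (C , C∈𝓣 , y-pick) x≢y =
        [ (λ B⊆C →
            [ (λ C⊆B → contradiction
                (pick-unique B∈𝓣 x-pick (subst (λ D → Pick D y) (⊆-antisym C⊆B B⊆C) y-pick)) x≢y)
            , (λ B⊆next → Edge-sym (later-edge C∈𝓣 y-pick B⊆next (proj₁ x-pick))) ]′
            (stage-compare C C∈𝓣 B B∈𝓣))
        , (λ C⊆next → later-edge B∈𝓣 x-pick C⊆next (proj₁ y-pick)) ]′
        (stage-compare B B∈𝓣 C C∈𝓣)

      Avoids : Carrier → Carrier → Set ℓ
      Avoids B D = ∀ x → x ∈ D → ¬ (x ∈ B)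

      avoids-adjunction : ∀ {B D D⁺ d} → IsAdjunction D⁺ D d → Avoids B D → ¬ (d ∈ B) → Avoids B D⁺
      avoids-adjunction {B} D⁺-spec B-avoids d∉B x x∈D⁺ x∈B =
        [ (λ x∈D → B-avoids x x∈D x∈B) , (λ x≡d → d∉B (subst (_∈ B) x≡d x∈B)) ]′
        (proj₁ (D⁺-spec x) x∈D⁺)

      -- If d is picked from C, the smaller of B and the next stage of C serves: the latter consists
      -- of neighbours of d, so irreflexivity keeps d out.
      stage-avoiding : ∀ {B D D⁺ d} → B ∈ 𝓣 → Avoids B D → Picked d → IsAdjunction D⁺ D d →
        ∃ λ B′ → B′ ∈ 𝓣 × Avoids B′ D⁺
      stage-avoiding {B} {d = d} B∈𝓣 B-avoids (C , C∈𝓣 , d-pick) D⁺-spec =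
        [ (λ C⊆B → next-avoids C⊆B (next-exists d-pick))
        , (λ B⊆next → B , B∈𝓣 , avoids-adjunction D⁺-spec B-avoids
            (R-irrefl d ∘ later-edge C∈𝓣 d-pick B⊆next)) ]′
        (stage-compare C C∈𝓣 B B∈𝓣)
        where
        next-avoids : C ⊆ B → (∃ λ C′ → Next C C′) → ∃ λ B′ → B′ ∈ 𝓣 × Avoids B′ _
        next-avoids C⊆B (C′ , C-next) =
          C′ , next∈𝓣 C∈𝓣 C-next , avoids-adjunction D⁺-spec
            (λ x x∈D x∈C′ → B-avoids x x∈D (C⊆B x (next⊆ C-next x x∈C′)))
            (R-irrefl d ∘ next-edge C∈𝓣 d-pick C-next)

      finite-avoided : ∀ {U} → Finite U → (∀ x → x ∈ U → Picked x) → ∃ λ B → B ∈ 𝓣 × Avoids B U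
      finite-avoided U-finite U-picked = finite-induction
        (∃′ ((v0 ∈′ v2) ∧′ (∀′ ((v0 ∈′ v2) ⇒′ (¬′ (v0 ∈′ v1)))))) (𝓣 ∷ []) U-finite
        (λ e e-empty → B₀ , B₀∈𝓣 , λ x x∈e → contradiction x∈e (e-empty x))
        (λ { D d D⁺ d∈U D⁺-spec (B , B∈𝓣 , B-avoids) →
             stage-avoiding B∈𝓣 B-avoids (U-picked d d∈U) D⁺-spec })

      -- If U were finite, some stage would avoid it; but the point picked from that stage lies in
      -- U.
      picked-infinite : ∀ U → (∀ x → x ∈ U ⟷ (x ∈ B₀ × Picked x)) → Infinite U
      picked-infinite U U-spec U-finite =
        unavoidable (finite-avoided U-finite λ x x∈U → proj₂ (proj₁ (U-spec x) x∈U))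
        where
        unavoidable : ¬ (∃ λ B → B ∈ 𝓣 × Avoids B U)
        unavoidable (B , B∈𝓣 , B-avoids) =
          let (x , x-pick) = pick-exists B B∈𝓣
          in B-avoids x
               (proj₂ (U-spec x) (stage⊆B₀ B∈𝓣 x (proj₁ x-pick) , B , B∈𝓣 , x-pick))
               (proj₁ x-pick)

      homogeneous : ∃ λ U → U ⊆ B₀ × Infinite U × (∀ x y → x ∈ U → y ∈ U → x ≢ y → Edge R x y)
      homogeneous =
        let (U , U-spec) = separation (∃′ ((v0 ∈′ v2) ∧′ pick′ v3 v4 v0 v1)) (𝓣 ∷ R ∷ j ∷ []) B₀
        in U , (λ x x∈U → proj₁ (proj₁ (U-spec x) x∈U)) , picked-infinite U U-spec ,
           λ x y x∈U y∈U → picked-edge (proj₂ (proj₁ (U-spec x) x∈U)) (proj₂ (proj₁ (U-spec y) y∈U))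

  -- Homogeneous sets for a partition of pairs

  module Partition {A X Y : Carrier} (isPartition : IsPartition A X Y) where

    IsHomogeneous : Carrier → Set ℓ
    IsHomogeneous B = (∀ s → s ∈[ B ]² → s ∈ X) ⊎ (∀ s → s ∈[ B ]² → s ∈ Y)

    pairs⊆ : ∀ {R U} → (∀ x y → x ∈ U → y ∈ U → x ≢ y → Edge R x y) → ∀ s → s ∈[ U ]² → s ∈ R
    pairs⊆ {R} edges s (x , y , x∈U , y∈U , x≢y , s-pair) =
      let (t , t-pair , t∈R) = edges x y x∈U y∈U x≢y
      in subst (_∈ R) (IsPair-unique t-pair s-pair) t∈R

    -- Members of R have two distinct elements, whereas {x, x} has only one.
    edge-irrefl : ∀ {R} → (∀ s → s ∈ R → s ∈[ A ]²) → ∀ x → ¬ Edge R x x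
    edge-irrefl R⊆ x (s , s-pair , s∈R) =
      let (a , b , _ , _ , a≢b , s-pair′) = R⊆ s s∈R
          member = λ c c∈s → [ id , id ]′ (proj₁ (s-pair c) c∈s)
      in a≢b (trans (member a (proj₂ (s-pair′ a) (inj₁ refl)))
               (sym (member b (proj₂ (s-pair′ b) (inj₂ refl)))))

    X-irrefl : ∀ x → ¬ Edge X x x
    X-irrefl = edge-irrefl λ s → proj₂ (proj₁ isPartition s) ∘ inj₁

    Y-irrefl : ∀ x → ¬ Edge Y x x
    Y-irrefl = edge-irrefl λ s → proj₂ (proj₁ isPartition s) ∘ inj₂

    edge-total : ∀ x y → x ∈ A → y ∈ A → x ≢ y → Edge X x y ⊎ Edge Y x y
    edge-total x y x∈A y∈A x≢y =
      let (s , s-pair) = pairing x y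
      in [ (λ s∈X → inj₁ (s , s-pair , s∈X)) , (λ s∈Y → inj₂ (s , s-pair , s∈Y)) ]′
           (proj₁ (proj₁ isPartition s) (x , y , x∈A , y∈A , x≢y , s-pair))

    -- Any x in B works. Its X-neighbours in B₀ are finite in number; were its Y-neighbours in B
    -- finite too, these two sets and {x} would make B finite.
    X-poor⇒Y-rich : ∀ {B₀ B} → B₀ ⊆ A → (∀ x → x ∈ B₀ → ¬ Rich X B₀ x) →
      B ⊆ B₀ → Infinite B → ∃ λ x → x ∈ B × Rich Y B x
    X-poor⇒Y-rich {B₀} {B} B₀⊆A X-poor B⊆B₀ B-infinite =
      let (x , x∈B) = infinite-inhabited B-infinite
          (M , M-spec) = neighbourhood X B₀ x
          (N , N-spec) = neighbourhood Y B x
          (N⁺ , N⁺-spec) = adjunction N x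
          M-finite = by-contradiction (finite′ v0) (M ∷ []) λ M-infinite →
            X-poor x (B⊆B₀ x x∈B) (M , M-spec , M-infinite)
      in x , x∈B , N , N-spec , λ N-finite →
           B-infinite (finite-cover (finite-adjunction N⁺-spec N-finite) M-finite λ z z∈B →
             [ (λ z≡x → inj₁ (proj₂ (N⁺-spec z) (inj₂ z≡x)))
             , (λ z≢x →
                 [ (λ xz∈X → inj₂ (proj₂ (M-spec z) (B⊆B₀ z z∈B , xz∈X)))
                 , (λ xz∈Y → inj₁ (proj₂ (N⁺-spec z) (inj₁ (proj₂ (N-spec z) (z∈B , xz∈Y))))) ]′
                 (edge-total x z (B₀⊆A x (B⊆B₀ x x∈B)) (B₀⊆A z (B⊆B₀ z z∈B)) (z≢x ∘ sym))) ]′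
             (z ≟ x))

    countable-ramsey : Countable A → Infinite A → ∃ λ B → B ⊆ A × Infinite B × IsHomogeneous B
    countable-ramsey (w , isOmega , j , isInjection) A-infinite
      -- The formula states that some infinite B₀ ⊆ A has no point with an infinite X-neighbourhood
      -- in B₀.
      with classical
        (∃′ ((v0 ⊆′ v1) ∧′ ((¬′ (finite′ v0)) ∧′ (∀′ ((v0 ∈′ v1) ⇒′ (¬′ (rich′ v3 v1 v0)))))))
        (A ∷ X ∷ [])
    ... | inj₁ (B₀ , B₀⊆A , B₀-infinite , X-poor) =
      let (U , U⊆B₀ , U-infinite , edges) =
            Enumerated.Homogeneous.homogeneous isOmega isInjection B₀⊆A B₀-infinite Y-irrefl
              (λ B B⊆B₀ → X-poor⇒Y-rich B₀⊆A X-poor B⊆B₀)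
      in U , (λ x x∈U → B₀⊆A x (U⊆B₀ x x∈U)) , U-infinite , inj₂ (pairs⊆ edges)
    ... | inj₂ no-X-poor =
      let (U , U⊆A , U-infinite , edges) =
            Enumerated.Homogeneous.homogeneous isOmega isInjection (λ _ → id) A-infinite X-irrefl
              (λ B B⊆A B-infinite →
                by-contradiction (∃′ ((v0 ∈′ v1) ∧′ rich′ v2 v1 v0)) (B ∷ X ∷ []) λ none →
                  no-X-poor (B , B⊆A , B-infinite , λ x x∈B x-rich → none (x , x∈B , x-rich)))
      in U , U⊆A , U-infinite , inj₁ (pairs⊆ edges)

    -- The partition as a two-colouring

    module Colouring {P c₀ c₁ k : Carrier} (P-spec : ∀ s → s ∈ P ⟷ (s ∈ X ⊎ s ∈ Y))
      (c₀-empty : IsEmpty c₀) (c₁-spec : IsPair c₁ c₀ c₀) (k-spec : IsPair k c₀ c₁) where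

      c₀≢c₁ : c₀ ≢ c₁
      c₀≢c₁ c₀≡c₁ = c₀-empty c₀ (subst (c₀ ∈_) (sym c₀≡c₁) (proj₂ (c₁-spec c₀) (inj₁ refl)))

      P-isPairSet : IsPairSet P A
      P-isPairSet s =
        proj₂ (proj₁ isPartition s) ∘ proj₁ (P-spec s) , proj₂ (P-spec s) ∘ proj₁ (proj₁ isPartition s)

      Entry : Carrier → Carrier → Set ℓ
      Entry s p = (s ∈ X × IsOrderedPair p s c₀) ⊎ (s ∈ Y × IsOrderedPair p s c₁)

      entry-unique : ∀ s p q → s ∈ P → Entry s p → Entry s q → p ≡ q
      entry-unique s p q _ (inj₁ (_ , p-pair))   (inj₁ (_ , q-pair))   = IsOrderedPair-unique p-pair q-pair
      entry-unique s p q _ (inj₁ (s∈X , _))      (inj₂ (s∈Y , _))      = contradiction (s∈X , s∈Y) (proj₂ isPartition s)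
      entry-unique s p q _ (inj₂ (s∈Y , _))      (inj₁ (s∈X , _))      = contradiction (s∈X , s∈Y) (proj₂ isPartition s)
      entry-unique s p q _ (inj₂ (_ , p-pair))   (inj₂ (_ , q-pair))   = IsOrderedPair-unique p-pair q-pair

      -- Replacement along s ↦ ⟨s, colour of s⟩, single-valued because X and Y are disjoint; no
      -- product P × k has to be formed.
      colouring : ∃ λ f → ∀ p → p ∈ f ⟷ (∃ λ s → s ∈ P × Entry s p)
      colouring = replacement
        (((v0 ∈′ v2) ∧′ isOrderedPair′ v1 v0 v4) ∨′ ((v0 ∈′ v3) ∧′ isOrderedPair′ v1 v0 v5))
        (X ∷ Y ∷ c₀ ∷ c₁ ∷ []) P entry-unique

      f = proj₁ colouring

      f-spec : ∀ p → p ∈ f ⟷ (∃ λ s → s ∈ P × Entry s p)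
      f-spec = proj₂ colouring

      Colour : Carrier → Carrier → Set ℓ
      Colour s c = (s ∈ X × c ≡ c₀) ⊎ (s ∈ Y × c ≡ c₁)

      app-f⇒colour : ∀ {s c} → ⟨ s , c ⟩∈ f → Colour s c
      app-f⇒colour (p , p-pair , p∈f) with proj₁ (f-spec p) p∈f
      ... | s′ , _ , inj₁ (s′∈X , p-pair′) with IsOrderedPair-injective p-pair p-pair′
      ...   | refl , c≡c₀ = inj₁ (s′∈X , c≡c₀)
      app-f⇒colour (p , p-pair , p∈f) | s′ , _ , inj₂ (s′∈Y , p-pair′)
        with IsOrderedPair-injective p-pair p-pair′
      ...   | refl , c≡c₁ = inj₂ (s′∈Y , c≡c₁)

      colour-unique : ∀ {s c d} → Colour s c → Colour s d → c ≡ d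
      colour-unique (inj₁ (_ , c≡c₀))  (inj₁ (_ , d≡c₀))  = trans c≡c₀ (sym d≡c₀)
      colour-unique (inj₁ (s∈X , _))   (inj₂ (s∈Y , _))   = contradiction (s∈X , s∈Y) (proj₂ isPartition _)
      colour-unique (inj₂ (s∈Y , _))   (inj₁ (s∈X , _))   = contradiction (s∈X , s∈Y) (proj₂ isPartition _)
      colour-unique (inj₂ (_ , c≡c₁))  (inj₂ (_ , d≡c₁))  = trans c≡c₁ (sym d≡c₁)

      f-isFunction : IsFunction f P k
      f-isFunction = bounds , total , λ s c d sc∈f sd∈f → colour-unique (app-f⇒colour sc∈f) (app-f⇒colour sd∈f)
        where
        bounds : ∀ p → p ∈ f → ∃ λ s → ∃ λ c → s ∈ P × c ∈ k × IsOrderedPair p s c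
        bounds p p∈f with proj₁ (f-spec p) p∈f
        ... | s , s∈P , inj₁ (_ , p-pair) = s , c₀ , s∈P , proj₂ (k-spec c₀) (inj₁ refl) , p-pair
        ... | s , s∈P , inj₂ (_ , p-pair) = s , c₁ , s∈P , proj₂ (k-spec c₁) (inj₂ refl) , p-pair

        entry : ∀ s c → s ∈ P → (∀ {p} → IsOrderedPair p s c → Entry s p) → ∃ λ d → ⟨ s , d ⟩∈ f
        entry s c s∈P make-entry =
          let (p , p-pair) = IsOrderedPair-exists s c
          in c , p , p-pair , proj₂ (f-spec p) (s , s∈P , make-entry p-pair)

        total : ∀ s → s ∈ P → ∃ λ c → ⟨ s , c ⟩∈ f
        total s s∈P =
          [ (λ s∈X → entry s c₀ s∈P λ p-pair → inj₁ (s∈X , p-pair))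
          , (λ s∈Y → entry s c₁ s∈P λ p-pair → inj₂ (s∈Y , p-pair)) ]′ (proj₁ (P-spec s) s∈P)

      mono₀⇒X : ∀ {S} → Monochromatic f c₀ S → ∀ s → s ∈[ S ]² → s ∈ X
      mono₀⇒X mono s (x , y , x∈S , y∈S , x≢y , s-pair) =
        [ proj₁ , (λ (_ , c₀≡c₁) → contradiction c₀≡c₁ c₀≢c₁) ]′
        (app-f⇒colour (mono x y x∈S y∈S x≢y s s-pair))

      mono₁⇒Y : ∀ {S} → Monochromatic f c₁ S → ∀ s → s ∈[ S ]² → s ∈ Y
      mono₁⇒Y mono s (x , y , x∈S , y∈S , x≢y , s-pair) =
        [ (λ (_ , c₁≡c₀) → contradiction (sym c₁≡c₀) c₀≢c₁) , proj₁ ]′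
        (app-f⇒colour (mono x y x∈S y∈S x≢y s s-pair))

    uncountable-ramsey : EDM → Uncountable A → ∃ λ B → B ⊆ A × Infinite B × IsHomogeneous B
    uncountable-ramsey edm A-uncountable =
      let (_ , ((c₀ , c₀-empty , _) , _) , _) = omega
          (c₁ , c₁-spec) = pairing c₀ c₀
          (k , k-spec) = pairing c₀ c₁
          (P , P-spec) = union₂ X Y
          open Colouring P-spec c₀-empty c₁-spec k-spec
      in [ (λ (S , S⊆A , S-uncountable , mono) →
             S , S⊆A , uncountable⇒infinite S-uncountable , inj₁ (mono₀⇒X mono))
         , (λ (S , S⊆A , S-countablyInfinite , mono) →
             S , S⊆A , countablyInfinite⇒infinite S-countablyInfinite , inj₂ (mono₁⇒Y mono)) ]′
         -- The graph on A gets the empty edge set `c₀`; the partition enters through the colouring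
         -- `f`.
         (edm A c₀ (λ e e∈c₀ → contradiction e∈c₀ (c₀-empty e)) A-uncountable
              P P-isPairSet c₀ c₁ k c₀-empty c₁-spec k-spec f f-isFunction)

theorem4p1 : ∀ {ℓ : Level} (𝓜 : Structure ℓ) → Classical 𝓜 → IsZFModel 𝓜 → SetTheory.EDM 𝓜 → SetTheory.RT 𝓜
theorem4p1 𝓜 classical zf edm A A-infinite X Y isPartition =
  [ (λ A-countable → countable-ramsey A-countable A-infinite) , uncountable-ramsey edm ]′
  (classical (countable′ v0) (A ∷ []))
  where
  open Partition 𝓜 classical zf isPartition
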